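{- Let $x_1\geq x_2\geq x_3\geq x_4$ be real numbers such that $x_1+x_4\geq x_2+x_3$. Let $a_1,a_2,a_3,a_4\in\mathbb{R}$ with $a_1\geq \max(|a_2|,|a_4|)$ and $a_3\geq |a_4|$, and let $g:\mathbb{R}\to\mathbb{R}$ be a function in class $\mathcal{G}$. Then $$\sum_{i=1}^4 a_i\prod_{\substack{1\leq j\leq 4\\ j\neq i}} g(x_i-x_j)\geq 0.$$
   Context: A function $g:\mathbb{R}\to\mathbb{R}$ is in class $\mathcal{G}$ if $g$ is either even or odd, $g(0)\geq 0$, and $g$ is monotonically nondecreasing on $[0,\infty)$. -}

module Defs where

open import Algebra.Bundles.Raw using (RawRing)
import Algebra.Definitions.RawSemiring as RawSemiringDefinitions
open import Data.Nat.Base as ℕ using (ℕ)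
import Data.Nat.Properties as ℕ
open import Data.Product.Base using (∃; _×_; _,_)
open import Data.Rational.Base as ℚ using (ℚ; 0ℚ; 1ℚ; ½)
import Data.Rational.Properties as ℚ
open import Data.Rational.Solver using (module +-*-Solver)
open import Data.Sum.Base using (_⊎_; inj₁; inj₂)
open import Data.Vec.Functional using (Vector)
open import Function.Bundles using (_⟶ₛ_; _⟨$⟩_)
open import Level using (0ℓ)
open import Relation.Binary.Bundles using (Setoid)
open import Relation.Binary.PropositionalEquality
  using (_≡_; refl; sym; trans; cong; cong₂; subst)

private
  variable
    p q r s ε : ℚ

module Estimates where

  half>0 : 0ℚ ℚ.< ε → 0ℚ ℚ.< ½ ℚ.* ε
  half>0 {ε} 0<ε =
    subst (ℚ._< ½ ℚ.* ε) (ℚ.*-zeroʳ ½) (ℚ.*-monoʳ-<-pos ½ 0<ε)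

  half+half : ∀ ε → ½ ℚ.* ε ℚ.+ ½ ℚ.* ε ≡ ε
  half+half ε =
    trans (sym (ℚ.*-distribʳ-+ ε ½ ½)) (ℚ.*-identityˡ ε)

  ∣p-p∣≤ε : ∀ p → 0ℚ ℚ.< ε → ℚ.∣ p ℚ.- p ∣ ℚ.≤ ε
  ∣p-p∣≤ε {ε} p 0<ε =
    subst (λ t → ℚ.∣ t ∣ ℚ.≤ ε) (sym (ℚ.+-inverseʳ p)) (ℚ.<⇒≤ 0<ε)

  ∣p-q∣≡∣q-p∣ : ∀ p q → ℚ.∣ p ℚ.- q ∣ ≡ ℚ.∣ q ℚ.- p ∣
  ∣p-q∣≡∣q-p∣ p q = trans (sym (ℚ.∣-p∣≡∣p∣ (p ℚ.- q)))
    (cong ℚ.∣_∣ (solve 2 (λ p q → :- (p :- q) := q :- p) refl p q))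
    where open +-*-Solver

  p≤∣p∣ : ∀ p → p ℚ.≤ ℚ.∣ p ∣
  p≤∣p∣ p with ℚ.≤-total 0ℚ p
  ... | inj₁ 0≤p = ℚ.≤-reflexive (sym (ℚ.0≤p⇒∣p∣≡p 0≤p))
  ... | inj₂ p≤0 = ℚ.≤-trans p≤0 (ℚ.0≤∣p∣ p)

  ∣p∣≤ : p ℚ.≤ r → ℚ.- p ℚ.≤ r → ℚ.∣ p ∣ ℚ.≤ r
  ∣p∣≤ {p} {r} p≤r -p≤r with ℚ.∣p∣≡p∨∣p∣≡-p p
  ... | inj₁ eq = subst (ℚ._≤ r) (sym eq) p≤r
  ... | inj₂ eq = subst (ℚ._≤ r) (sym eq) -p≤r

  close⇒≤ : ℚ.∣ p ℚ.- q ∣ ℚ.≤ r → p ℚ.≤ q ℚ.+ r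
  close⇒≤ {p} {q} {r} h = begin
    p                     ≡⟨ solve 2 (λ p q → p := q :+ (p :- q)) refl p q ⟩
    q ℚ.+ (p ℚ.- q)       ≤⟨ ℚ.+-monoʳ-≤ q (ℚ.≤-trans (p≤∣p∣ (p ℚ.- q)) h) ⟩
    q ℚ.+ r               ∎
    where
    open ℚ.≤-Reasoning
    open +-*-Solver

  ≤⇒diff≤ : p ℚ.≤ q ℚ.+ r → p ℚ.- q ℚ.≤ r
  ≤⇒diff≤ {p} {q} {r} h = begin
    p ℚ.- q               ≤⟨ ℚ.+-monoˡ-≤ (ℚ.- q) h ⟩
    q ℚ.+ r ℚ.- q         ≡⟨ solve 2 (λ q r → q :+ r :- q := r) refl q r ⟩
    r                     ∎
    where
    open ℚ.≤-Reasoning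
    open +-*-Solver

  ≤⇒close : p ℚ.≤ q ℚ.+ r → q ℚ.≤ p ℚ.+ r → ℚ.∣ p ℚ.- q ∣ ℚ.≤ r
  ≤⇒close {p} {q} {r} h k = ∣p∣≤ (≤⇒diff≤ h)
    (subst (ℚ._≤ r) (solve 2 (λ p q → q :- p := :- (p :- q)) refl p q) (≤⇒diff≤ k))
    where open +-*-Solver

  +-close : ∀ {δ} p q r s → ℚ.∣ p ℚ.- r ∣ ℚ.≤ ε → ℚ.∣ q ℚ.- s ∣ ℚ.≤ δ →
            ℚ.∣ (p ℚ.+ q) ℚ.- (r ℚ.+ s) ∣ ℚ.≤ ε ℚ.+ δ
  +-close {ε} {δ} p q r s h k = begin
    ℚ.∣ (p ℚ.+ q) ℚ.- (r ℚ.+ s) ∣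
      ≡⟨ cong ℚ.∣_∣ (solve 4 (λ p q r s → (p :+ q) :- (r :+ s) := (p :- r) :+ (q :- s))
                       refl p q r s) ⟩
    ℚ.∣ (p ℚ.- r) ℚ.+ (q ℚ.- s) ∣
      ≤⟨ ℚ.∣p+q∣≤∣p∣+∣q∣ (p ℚ.- r) (q ℚ.- s) ⟩
    ℚ.∣ p ℚ.- r ∣ ℚ.+ ℚ.∣ q ℚ.- s ∣
      ≤⟨ ℚ.+-mono-≤ h k ⟩
    ε ℚ.+ δ ∎
    where
    open ℚ.≤-Reasoning
    open +-*-Solver

  *-close : ∀ {δ} B .{{_ : ℚ.NonNegative B}} p q r s →
            ℚ.∣ q ∣ ℚ.≤ B → ℚ.∣ r ∣ ℚ.≤ B →
            ℚ.∣ p ℚ.- r ∣ ℚ.≤ δ → ℚ.∣ q ℚ.- s ∣ ℚ.≤ δ →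
            ℚ.∣ (p ℚ.* q) ℚ.- (r ℚ.* s) ∣ ℚ.≤ B ℚ.* δ ℚ.+ B ℚ.* δ
  *-close {δ} B p q r s ∣q∣≤B ∣r∣≤B h k = begin
    ℚ.∣ (p ℚ.* q) ℚ.- (r ℚ.* s) ∣
      ≡⟨ cong ℚ.∣_∣ (solve 4 (λ p q r s →
           (p :* q) :- (r :* s) := q :* (p :- r) :+ r :* (q :- s)) refl p q r s) ⟩
    ℚ.∣ q ℚ.* (p ℚ.- r) ℚ.+ r ℚ.* (q ℚ.- s) ∣
      ≤⟨ ℚ.∣p+q∣≤∣p∣+∣q∣ (q ℚ.* (p ℚ.- r)) (r ℚ.* (q ℚ.- s)) ⟩
    ℚ.∣ q ℚ.* (p ℚ.- r) ∣ ℚ.+ ℚ.∣ r ℚ.* (q ℚ.- s) ∣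
      ≤⟨ ℚ.+-mono-≤ (∣*∣≤ q (p ℚ.- r) ∣q∣≤B h) (∣*∣≤ r (q ℚ.- s) ∣r∣≤B k) ⟩
    B ℚ.* δ ℚ.+ B ℚ.* δ ∎
    where
    open ℚ.≤-Reasoning
    open +-*-Solver
    ∣*∣≤ : ∀ u v → ℚ.∣ u ∣ ℚ.≤ B → ℚ.∣ v ∣ ℚ.≤ δ → ℚ.∣ u ℚ.* v ∣ ℚ.≤ B ℚ.* δ
    ∣*∣≤ u v ∣u∣≤B ∣v∣≤δ = begin
      ℚ.∣ u ℚ.* v ∣           ≡⟨ ℚ.∣p*q∣≡∣p∣*∣q∣ u v ⟩
      ℚ.∣ u ∣ ℚ.* ℚ.∣ v ∣     ≤⟨ ℚ.*-monoʳ-≤-nonNeg ℚ.∣ v ∣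
                                   {{ℚ.nonNegative (ℚ.0≤∣p∣ v)}} ∣u∣≤B ⟩
      B ℚ.* ℚ.∣ v ∣           ≤⟨ ℚ.*-monoˡ-≤-nonNeg B ∣v∣≤δ ⟩
      B ℚ.* δ                 ∎

  neg-close : ∀ p q → ℚ.∣ p ℚ.- q ∣ ℚ.≤ ε → ℚ.∣ (ℚ.- p) ℚ.- (ℚ.- q) ∣ ℚ.≤ ε
  neg-close {ε} p q = subst (ℚ._≤ ε) (trans (∣p-q∣≡∣q-p∣ p q)
    (cong ℚ.∣_∣ (solve 2 (λ p q → q :- p := (:- p) :- (:- q)) refl p q)))
    where open +-*-Solver

  ⊔-≤+ : ∀ p q r s → p ℚ.≤ r ℚ.+ ε → q ℚ.≤ s ℚ.+ ε → p ℚ.⊔ q ℚ.≤ (r ℚ.⊔ s) ℚ.+ ε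
  ⊔-≤+ {ε} p q r s h k = ℚ.⊔-lub
    (ℚ.≤-trans h (ℚ.+-monoˡ-≤ ε (ℚ.p≤p⊔q r s)))
    (ℚ.≤-trans k (ℚ.+-monoˡ-≤ ε (ℚ.p≤q⊔p r s)))

  ⊔-close : ∀ p q r s → ℚ.∣ p ℚ.- r ∣ ℚ.≤ ε → ℚ.∣ q ℚ.- s ∣ ℚ.≤ ε →
            ℚ.∣ (p ℚ.⊔ q) ℚ.- (r ℚ.⊔ s) ∣ ℚ.≤ ε
  ⊔-close {ε} p q r s h k = ≤⇒close
    (⊔-≤+ p q r s (close⇒≤ h) (close⇒≤ k))
    (⊔-≤+ r s p q (close⇒≤ (subst (ℚ._≤ ε) (∣p-q∣≡∣q-p∣ p r) h))
                  (close⇒≤ (subst (ℚ._≤ ε) (∣p-q∣≡∣q-p∣ q s) k)))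

  shrink : ∀ B → 0ℚ ℚ.< B → 0ℚ ℚ.< ε → ∃ λ δ → 0ℚ ℚ.< δ × B ℚ.* δ ℚ.+ B ℚ.* δ ≡ ε
  shrink {ε} B 0<B 0<ε =
    1/B ℚ.* (½ ℚ.* ε)
    , subst (ℚ._< 1/B ℚ.* (½ ℚ.* ε)) (ℚ.*-zeroʳ 1/B)
        (ℚ.*-monoʳ-<-pos 1/B {{ℚ.1/pos⇒pos B}} (half>0 0<ε))
    , trans (cong₂ ℚ._+_ B*δ B*δ) (half+half ε)
    where
    instance
      B-positive : ℚ.Positive B
      B-positive = ℚ.positive 0<B
      B-nonZero : ℚ.NonZero B
      B-nonZero = ℚ.pos⇒nonZero B
    1/B : ℚ
    1/B = ℚ.1/ B
    B*δ : B ℚ.* (1/B ℚ.* (½ ℚ.* ε)) ≡ ½ ℚ.* ε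
    B*δ = trans (sym (ℚ.*-assoc B 1/B (½ ℚ.* ε)))
      (trans (cong (ℚ._* (½ ℚ.* ε)) (ℚ.*-inverseʳ B)) (ℚ.*-identityˡ (½ ℚ.* ε)))

open Estimates

IsCauchy : (ℕ → ℚ) → Set
IsCauchy f = ∀ ε → 0ℚ ℚ.< ε →
  ∃ λ N → ∀ m n → N ℕ.≤ m → N ℕ.≤ n → ℚ.∣ f m ℚ.- f n ∣ ℚ.≤ ε

record ℝ : Set where
  constructor mkℝ
  field
    seq    : ℕ → ℚ
    cauchy : IsCauchy seq

open ℝ public

infix  4 _≃_ _≤_ _≥_
infixl 6 _+_ _-_ _⊔_
infixl 7 _*_
infix  8 -_

-- The difference of the two sequences tends to 0.
_≃_ : ℝ → ℝ → Set
x ≃ y = ∀ ε → 0ℚ ℚ.< ε →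
  ∃ λ N → ∀ n → N ℕ.≤ n → ℚ.∣ seq x n ℚ.- seq y n ∣ ℚ.≤ ε

-- The slack ε is what makes this respect _≃_: a termwise comparison of
-- representatives would not.
_≤_ : ℝ → ℝ → Set
x ≤ y = ∀ ε → 0ℚ ℚ.< ε →
  ∃ λ N → ∀ n → N ℕ.≤ n → seq x n ℚ.≤ seq y n ℚ.+ ε

_≥_ : ℝ → ℝ → Set
x ≥ y = y ≤ x

fromℚ : ℚ → ℝ
fromℚ p = mkℝ (λ _ → p) λ ε 0<ε → 0 , λ _ _ _ _ → ∣p-p∣≤ε p 0<ε

0ℝ 1ℝ : ℝ
0ℝ = fromℚ 0ℚ
1ℝ = fromℚ 1ℚ

private
  *-closeFrom : ∀ (f g : ℕ → ℚ) K L M N {A B δ} → 0ℚ ℚ.< A →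
    (∀ n → K ℕ.≤ n → ℚ.∣ f n ∣ ℚ.≤ A) →
    (∀ n → L ℕ.≤ n → ℚ.∣ g n ∣ ℚ.≤ B) →
    (∀ m n → M ℕ.≤ m → M ℕ.≤ n → ℚ.∣ f m ℚ.- f n ∣ ℚ.≤ δ) →
    (∀ m n → N ℕ.≤ m → N ℕ.≤ n → ℚ.∣ g m ℚ.- g n ∣ ℚ.≤ δ) →
    (A ℚ.⊔ B) ℚ.* δ ℚ.+ (A ℚ.⊔ B) ℚ.* δ ≡ ε →
    ∀ m n → (K ℕ.⊔ L) ℕ.⊔ (M ℕ.⊔ N) ℕ.≤ m → (K ℕ.⊔ L) ℕ.⊔ (M ℕ.⊔ N) ℕ.≤ n →
    ℚ.∣ (f m ℚ.* g m) ℚ.- (f n ℚ.* g n) ∣ ℚ.≤ ε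
  *-closeFrom f g K L M N {A} {B} 0<A hA hB hf hg refl m n l k =
    *-close (A ℚ.⊔ B) {{ℚ.nonNegative (ℚ.≤-trans (ℚ.<⇒≤ 0<A) (ℚ.p≤p⊔q A B))}}
      (f m) (g m) (f n) (g n)
      (ℚ.≤-trans (hB m (ℕ.m⊔n≤o⇒n≤o K L (KL l))) (ℚ.p≤q⊔p A B))
      (ℚ.≤-trans (hA n (ℕ.m⊔n≤o⇒m≤o K L (KL k))) (ℚ.p≤p⊔q A B))
      (hf m n (ℕ.m⊔n≤o⇒m≤o M N (MN l)) (ℕ.m⊔n≤o⇒m≤o M N (MN k)))
      (hg m n (ℕ.m⊔n≤o⇒n≤o M N (MN l)) (ℕ.m⊔n≤o⇒n≤o M N (MN k)))
    where
    KL : ∀ {o} → (K ℕ.⊔ L) ℕ.⊔ (M ℕ.⊔ N) ℕ.≤ o → K ℕ.⊔ L ℕ.≤ o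
    KL = ℕ.m⊔n≤o⇒m≤o (K ℕ.⊔ L) (M ℕ.⊔ N)
    MN : ∀ {o} → (K ℕ.⊔ L) ℕ.⊔ (M ℕ.⊔ N) ℕ.≤ o → M ℕ.⊔ N ℕ.≤ o
    MN = ℕ.m⊔n≤o⇒n≤o (K ℕ.⊔ L) (M ℕ.⊔ N)

abstract
  +-cauchy : ∀ x y → IsCauchy (λ n → seq x n ℚ.+ seq y n)
  +-cauchy x y ε 0<ε =
    let (M , hx) = cauchy x (½ ℚ.* ε) (half>0 0<ε)
        (N , hy) = cauchy y (½ ℚ.* ε) (half>0 0<ε)
    in M ℕ.⊔ N , λ m n l k →
       subst (ℚ.∣ (seq x m ℚ.+ seq y m) ℚ.- (seq x n ℚ.+ seq y n) ∣ ℚ.≤_) (half+half ε)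
         (+-close (seq x m) (seq y m) (seq x n) (seq y n)
           (hx m n (ℕ.m⊔n≤o⇒m≤o M N l) (ℕ.m⊔n≤o⇒m≤o M N k))
           (hy m n (ℕ.m⊔n≤o⇒n≤o M N l) (ℕ.m⊔n≤o⇒n≤o M N k)))

  neg-cauchy : ∀ x → IsCauchy (λ n → ℚ.- seq x n)
  neg-cauchy x ε 0<ε =
    let (N , h) = cauchy x ε 0<ε
    in N , λ m n l k → neg-close (seq x m) (seq x n) (h m n l k)

  ⊔-cauchy : ∀ x y → IsCauchy (λ n → seq x n ℚ.⊔ seq y n)
  ⊔-cauchy x y ε 0<ε =
    let (M , hx) = cauchy x ε 0<ε
        (N , hy) = cauchy y ε 0<ε
    in M ℕ.⊔ N , λ m n l k →
       ⊔-close (seq x m) (seq y m) (seq x n) (seq y n)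
         (hx m n (ℕ.m⊔n≤o⇒m≤o M N l) (ℕ.m⊔n≤o⇒m≤o M N k))
         (hy m n (ℕ.m⊔n≤o⇒n≤o M N l) (ℕ.m⊔n≤o⇒n≤o M N k))

  eventuallyBounded : ∀ x →
    ∃ λ B → 0ℚ ℚ.< B × ∃ λ N → ∀ n → N ℕ.≤ n → ℚ.∣ seq x n ∣ ℚ.≤ B
  eventuallyBounded x =
    let (N , h) = cauchy x 1ℚ (ℚ.positive⁻¹ 1ℚ)
        b       = seq x N
    in ℚ.∣ b ∣ ℚ.+ 1ℚ
     , ℚ.+-mono-≤-< (ℚ.0≤∣p∣ b) (ℚ.positive⁻¹ 1ℚ)
     , N
     , λ n l → begin
         ℚ.∣ seq x n ∣
           ≡⟨ cong ℚ.∣_∣ (solve 2 (λ p q → p := q :+ (p :- q)) refl (seq x n) b) ⟩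
         ℚ.∣ b ℚ.+ (seq x n ℚ.- b) ∣
           ≤⟨ ℚ.∣p+q∣≤∣p∣+∣q∣ b (seq x n ℚ.- b) ⟩
         ℚ.∣ b ∣ ℚ.+ ℚ.∣ seq x n ℚ.- b ∣
           ≤⟨ ℚ.+-monoʳ-≤ ℚ.∣ b ∣ (h n N l ℕ.≤-refl) ⟩
         ℚ.∣ b ∣ ℚ.+ 1ℚ ∎
    where
    open ℚ.≤-Reasoning
    open +-*-Solver

  *-cauchy : ∀ x y → IsCauchy (λ n → seq x n ℚ.* seq y n)
  *-cauchy x y ε 0<ε =
    let (A , 0<A , K , hA) = eventuallyBounded x
        (B , 0<B , L , hB) = eventuallyBounded y
        (δ , 0<δ , eq)     = shrink (A ℚ.⊔ B) (ℚ.<-≤-trans 0<A (ℚ.p≤p⊔q A B)) 0<ε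
        (M , hx)           = cauchy x δ 0<δ
        (N , hy)           = cauchy y δ 0<δ
    in (K ℕ.⊔ L) ℕ.⊔ (M ℕ.⊔ N)
     , *-closeFrom (seq x) (seq y) K L M N 0<A hA hB hx hy eq

_+_ : ℝ → ℝ → ℝ
x + y = mkℝ (λ n → seq x n ℚ.+ seq y n) (+-cauchy x y)

-_ : ℝ → ℝ
- x = mkℝ (λ n → ℚ.- seq x n) (neg-cauchy x)

_-_ : ℝ → ℝ → ℝ
x - y = x + (- y)

_*_ : ℝ → ℝ → ℝ
x * y = mkℝ (λ n → seq x n ℚ.* seq y n) (*-cauchy x y)

_⊔_ : ℝ → ℝ → ℝ
x ⊔ y = mkℝ (λ n → seq x n ℚ.⊔ seq y n) (⊔-cauchy x y)

∣_∣ : ℝ → ℝ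
∣ x ∣ = x ⊔ (- x)

ℝ-setoid : Setoid 0ℓ 0ℓ
ℝ-setoid = record
  { Carrier       = ℝ
  ; _≈_           = _≃_
  ; isEquivalence = record
    { refl  = λ {x} ε 0<ε → 0 , λ n _ → ∣p-p∣≤ε (seq x n) 0<ε
    ; sym   = λ {x} {y} h ε 0<ε →
        let (N , k) = h ε 0<ε
        in N , λ n l → subst (ℚ._≤ ε) (∣p-q∣≡∣q-p∣ (seq x n) (seq y n)) (k n l)
    ; trans = λ {x} {y} {z} → ≃-trans x y z
    }
  }
  where
  ≃-trans : ∀ x y z → x ≃ y → y ≃ z → x ≃ z
  ≃-trans x y z h k ε 0<ε =
    let (M , h′) = h (½ ℚ.* ε) (half>0 0<ε)
        (N , k′) = k (½ ℚ.* ε) (half>0 0<ε)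
    in M ℕ.⊔ N , λ n l →
       let p = seq x n ; q = seq y n ; r = seq z n in begin
       ℚ.∣ p ℚ.- r ∣
         ≡⟨ cong ℚ.∣_∣ (solve 3 (λ p q r → p :- r := (p :- q) :+ (q :- r)) refl p q r) ⟩
       ℚ.∣ (p ℚ.- q) ℚ.+ (q ℚ.- r) ∣
         ≤⟨ ℚ.∣p+q∣≤∣p∣+∣q∣ (p ℚ.- q) (q ℚ.- r) ⟩
       ℚ.∣ p ℚ.- q ∣ ℚ.+ ℚ.∣ q ℚ.- r ∣
         ≤⟨ ℚ.+-mono-≤ (h′ n (ℕ.m⊔n≤o⇒m≤o M N l)) (k′ n (ℕ.m⊔n≤o⇒n≤o M N l)) ⟩
       ½ ℚ.* ε ℚ.+ ½ ℚ.* ε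
         ≡⟨ half+half ε ⟩
       ε ∎
    where
    open ℚ.≤-Reasoning
    open +-*-Solver

ℝ-rawRing : RawRing 0ℓ 0ℓ
ℝ-rawRing = record
  { Carrier = ℝ
  ; _≈_     = _≃_
  ; _+_     = _+_
  ; _*_     = _*_
  ; -_      = -_
  ; 0#      = 0ℝ
  ; 1#      = 1ℝ
  }

sum product : ∀ {n} → Vector ℝ n → ℝ
sum     = RawSemiringDefinitions.sum (RawRing.rawSemiring ℝ-rawRing)
product = RawSemiringDefinitions.product (RawRing.rawSemiring ℝ-rawRing)

-- A real function is a map of setoids: a function on Cauchy sequences
-- that sends equal reals to equal reals.
ℝ⟶ℝ : Set
ℝ⟶ℝ = ℝ-setoid ⟶ₛ ℝ-setoid

Even Odd : ℝ⟶ℝ → Set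
Even g = ∀ x → g ⟨$⟩ (- x) ≃ g ⟨$⟩ x
Odd  g = ∀ x → g ⟨$⟩ (- x) ≃ - (g ⟨$⟩ x)

record 𝒢 (g : ℝ⟶ℝ) : Set where
  field
    parity           : Even g ⊎ Odd g
    nonNegative-at-0 : g ⟨$⟩ 0ℝ ≥ 0ℝ
    nondecreasing    : ∀ x y → 0ℝ ≤ x → x ≤ y → g ⟨$⟩ x ≤ g ⟨$⟩ y

{-# OPTIONS --safe #-}

-- Write A, …, F for the values of g at the six differences xᵢ − xⱼ ≥ 0 with
-- i < j.  The parity of g turns the remaining values into σ A, …, σ F with
-- σ = ±1, so the sum is a₁P + σa₂Q + a₃R + σa₄T with P = ADF, Q = ABE,
-- R = DBC, T = FEC.  With c = ∣a₄∣ it equals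
--   (a₁ + σa₂)Q + (a₁ − c)(P − Q) + (a₃ − c)R + (c + σa₄)T + c((P − Q) + (R − T)),
-- and every factor is nonnegative: the last one because
--   (P − Q) + (R − T) = (F − B)(A(D − E) + (A − C)E) + B(A + C)(D − E),
-- where A ≥ C and D ≥ E come from x₁ + x₄ ≥ x₂ + x₃.

module Submission where

open import Defs
open Defs.Estimates
import Data.Nat.Base as ℕ
import Data.Nat.Properties as ℕ
open import Data.Product.Base using (∃; _×_; _,_)
open import Data.Rational.Base as ℚ using (ℚ; 0ℚ; 1ℚ; ½)
import Data.Rational.Properties as ℚ
open import Data.Rational.Solver using (module +-*-Solver)
open import Data.Sum.Base using (inj₁; inj₂)
open import Data.Vec.Functional using (Vector; []; _∷_; removeAt)
open import Function.Bundles using (_⟨$⟩_; module Func)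
open import Relation.Binary.Bundles using (Setoid)
open import Relation.Binary.PropositionalEquality
  using (_≡_; refl; sym; trans; cong; subst)

open +-*-Solver using (solve; _:=_; _:+_; _:*_; _:-_; :-_; con)

-- Equality and order of Cauchy reals.

infix 4 _≈_ _≲_

-- _≃_ and _≤_ unfold to statements about seq, from which Agda cannot recover
-- the reals; as records they allow the reals to be implicit.
record _≈_ (x y : ℝ) : Set where
  constructor wrap
  field unwrap : x ≃ y

record _≲_ (x y : ℝ) : Set where
  constructor wrap
  field unwrap : x ≤ y

private
  variable
    u v x y z : ℝ

module ≃ = Setoid ℝ-setoid

≈-refl : x ≈ x
≈-refl {x} = wrap (≃.refl {x})

≈-sym : x ≈ y → y ≈ x
≈-sym {x} {y} (wrap h) = wrap (≃.sym {x} {y} h)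

≈-trans : x ≈ y → y ≈ z → x ≈ z
≈-trans {x} {y} {z} (wrap h) (wrap k) = wrap (≃.trans {x} {y} {z} h k)

-- Since the operations act termwise, this reduces ring identities over `ℝ` to the rational solver
-- at each index.
pointwise-≈ : (∀ n → seq x n ≡ seq y n) → x ≈ y
pointwise-≈ {x} {y} h = wrap λ ε 0<ε → 0 , λ n _ →
  subst (λ t → ℚ.∣ seq x n ℚ.- t ∣ ℚ.≤ ε) (h n) (∣p-p∣≤ε (seq x n) 0<ε)

pointwise-≲ : (∀ n → seq x n ℚ.≤ seq y n) → x ≲ y
pointwise-≲ {x} {y} h = wrap λ ε 0<ε → 0 , λ n _ → begin
  seq x n           ≤⟨ h n ⟩
  seq y n           ≡⟨ ℚ.+-identityʳ (seq y n) ⟨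
  seq y n ℚ.+ 0ℚ    ≤⟨ ℚ.+-monoʳ-≤ (seq y n) (ℚ.<⇒≤ 0<ε) ⟩
  seq y n ℚ.+ ε     ∎
  where open ℚ.≤-Reasoning

≈⇒≲ : x ≈ y → x ≲ y
≈⇒≲ (wrap h) = wrap λ ε 0<ε →
  let (N , k) = h ε 0<ε in N , λ n l → close⇒≤ (k n l)

≲-refl : x ≲ x
≲-refl = ≈⇒≲ ≈-refl

≲-trans : x ≲ y → y ≲ z → x ≲ z
≲-trans {x} {y} {z} (wrap h) (wrap k) = wrap λ ε 0<ε →
  let (M , h′) = h (½ ℚ.* ε) (half>0 0<ε)
      (N , k′) = k (½ ℚ.* ε) (half>0 0<ε)
      δ        = ½ ℚ.* ε
  in M ℕ.⊔ N , λ n l → begin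
     seq x n                   ≤⟨ h′ n (ℕ.m⊔n≤o⇒m≤o M N l) ⟩
     seq y n ℚ.+ δ             ≤⟨ ℚ.+-monoˡ-≤ δ (k′ n (ℕ.m⊔n≤o⇒n≤o M N l)) ⟩
     seq z n ℚ.+ δ ℚ.+ δ       ≡⟨ ℚ.+-assoc (seq z n) δ δ ⟩
     seq z n ℚ.+ (δ ℚ.+ δ)     ≡⟨ cong (seq z n ℚ.+_) (half+half ε) ⟩
     seq z n ℚ.+ ε             ∎
  where open ℚ.≤-Reasoning

-- Compatibility of arithmetic with equality and order.

+-cong : x ≈ y → u ≈ v → x + u ≈ y + v
+-cong {x} {y} {u} {v} (wrap h) (wrap k) = wrap λ ε 0<ε →
  let (M , h′) = h (½ ℚ.* ε) (half>0 0<ε)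
      (N , k′) = k (½ ℚ.* ε) (half>0 0<ε)
  in M ℕ.⊔ N , λ n l →
     subst (ℚ.∣ (seq x n ℚ.+ seq u n) ℚ.- (seq y n ℚ.+ seq v n) ∣ ℚ.≤_) (half+half ε)
       (+-close (seq x n) (seq u n) (seq y n) (seq v n)
         (h′ n (ℕ.m⊔n≤o⇒m≤o M N l)) (k′ n (ℕ.m⊔n≤o⇒n≤o M N l)))

*-cong : x ≈ y → u ≈ v → x * u ≈ y * v
*-cong {x} {y} {u} {v} (wrap h) (wrap k) = wrap λ ε 0<ε →
  -- Bounds for `u` and `y` suffice because xu - yv = u(x - y) + y(u - v).
  let (A , 0<A , K , hA) = eventuallyBounded u
      (B , 0<B , L , hB) = eventuallyBounded y
      (δ , 0<δ , eq)     = shrink (A ℚ.⊔ B) (ℚ.<-≤-trans 0<A (ℚ.p≤p⊔q A B)) 0<ε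
      (M , h′)           = h δ 0<δ
      (N , k′)           = k δ 0<δ
  in (K ℕ.⊔ L) ℕ.⊔ (M ℕ.⊔ N) , λ n l →
     let KL = ℕ.m⊔n≤o⇒m≤o (K ℕ.⊔ L) (M ℕ.⊔ N) l
         MN = ℕ.m⊔n≤o⇒n≤o (K ℕ.⊔ L) (M ℕ.⊔ N) l
     in subst (ℚ.∣ (seq x n ℚ.* seq u n) ℚ.- (seq y n ℚ.* seq v n) ∣ ℚ.≤_) eq
          (*-close (A ℚ.⊔ B)
            {{ℚ.nonNegative (ℚ.≤-trans (ℚ.<⇒≤ 0<A) (ℚ.p≤p⊔q A B))}}
            (seq x n) (seq u n) (seq y n) (seq v n)
            (ℚ.≤-trans (hA n (ℕ.m⊔n≤o⇒m≤o K L KL)) (ℚ.p≤p⊔q A B))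
            (ℚ.≤-trans (hB n (ℕ.m⊔n≤o⇒n≤o K L KL)) (ℚ.p≤q⊔p A B))
            (h′ n (ℕ.m⊔n≤o⇒m≤o M N MN))
            (k′ n (ℕ.m⊔n≤o⇒n≤o M N MN)))

+-mono-≲ : x ≲ y → u ≲ v → x + u ≲ y + v
+-mono-≲ {x} {y} {u} {v} (wrap h) (wrap k) = wrap λ ε 0<ε →
  let (M , h′) = h (½ ℚ.* ε) (half>0 0<ε)
      (N , k′) = k (½ ℚ.* ε) (half>0 0<ε)
      δ        = ½ ℚ.* ε
  in M ℕ.⊔ N , λ n l → begin
     seq x n ℚ.+ seq u n
       ≤⟨ ℚ.+-mono-≤ (h′ n (ℕ.m⊔n≤o⇒m≤o M N l)) (k′ n (ℕ.m⊔n≤o⇒n≤o M N l)) ⟩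
     (seq y n ℚ.+ δ) ℚ.+ (seq v n ℚ.+ δ)
       ≡⟨ solve 3 (λ p q r → (p :+ r) :+ (q :+ r) := (p :+ q) :+ (r :+ r))
            refl (seq y n) (seq v n) δ ⟩
     (seq y n ℚ.+ seq v n) ℚ.+ (δ ℚ.+ δ)
       ≡⟨ cong ((seq y n ℚ.+ seq v n) ℚ.+_) (half+half ε) ⟩
     (seq y n ℚ.+ seq v n) ℚ.+ ε ∎
  where open ℚ.≤-Reasoning

-- Add `u - x` to both sides. Rearranging an inequality thus becomes checking one ring identity.
≲-by-difference : y - x ≈ v - u → x ≲ y → u ≲ v
≲-by-difference {y} {x} {v} {u} h x≲y =
  ≲-trans (≈⇒≲ u≈x+[u-x]) (≲-trans (+-mono-≲ x≲y (≲-refl {u - x}))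
  (≲-trans (≈⇒≲ y+[u-x]≈u+[y-x]) (≲-trans (≈⇒≲ (+-cong (≈-refl {u}) h))
  (≈⇒≲ u+[v-u]≈v))))
  where
  u≈x+[u-x] : u ≈ x + (u - x)
  u≈x+[u-x] = pointwise-≈ λ n →
    solve 2 (λ p q → q := p :+ (q :- p)) refl (seq x n) (seq u n)
  y+[u-x]≈u+[y-x] : y + (u - x) ≈ u + (y - x)
  y+[u-x]≈u+[y-x] = pointwise-≈ λ n →
    solve 3 (λ p q r → q :+ (r :- p) := r :+ (q :- p))
      refl (seq x n) (seq y n) (seq u n)
  u+[v-u]≈v : u + (v - u) ≈ v
  u+[v-u]≈v = pointwise-≈ λ n →
    solve 2 (λ p q → p :+ (q :- p) := q) refl (seq u n) (seq v n)

neg-mono-≲ : x ≲ y → - y ≲ - x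
neg-mono-≲ {x} {y} = ≲-by-difference (pointwise-≈ λ n →
  solve 2 (λ p q → q :- p := :- p :- (:- q)) refl (seq x n) (seq y n))

x≲y⇒0≲y-x : x ≲ y → 0ℝ ≲ y - x
x≲y⇒0≲y-x {x} {y} = ≲-by-difference (pointwise-≈ λ n →
  solve 2 (λ p q → q :- p := (q :- p) :- con 0ℚ) refl (seq x n) (seq y n))

0≲+ : 0ℝ ≲ x → 0ℝ ≲ y → 0ℝ ≲ x + y
0≲+ h k = ≲-trans (≈⇒≲ (pointwise-≈ λ n → refl)) (+-mono-≲ h k)

-- Eventually each term of `x` is at least -ε, so cutting it off at 0 moves it by at most ε.
0≲x⇒x≈x⊔0 : 0ℝ ≲ x → x ≈ x ⊔ 0ℝ
0≲x⇒x≈x⊔0 {x} (wrap h) = wrap λ ε 0<ε →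
  let (N , k) = h ε 0<ε
  in N , λ n l → let p = seq x n in ≤⇒close
       (ℚ.≤-trans (ℚ.p≤p⊔q p 0ℚ)
         (close⇒≤ {p ℚ.⊔ 0ℚ} {p ℚ.⊔ 0ℚ} (∣p-p∣≤ε (p ℚ.⊔ 0ℚ) 0<ε)))
       (ℚ.⊔-lub (close⇒≤ {p} {p} (∣p-p∣≤ε p 0<ε)) (k n l))

-- Replacing x by x ⊔ 0 makes the representatives nonnegative, so that the
-- product is nonnegative termwise.
0≲* : 0ℝ ≲ x → 0ℝ ≲ y → 0ℝ ≲ x * y
0≲* {x} {y} h k =
  ≲-trans (pointwise-≲ λ n → nonNeg (ℚ.p≤q⊔p (seq x n) 0ℚ) (ℚ.p≤q⊔p (seq y n) 0ℚ))
    (≈⇒≲ (≈-sym (*-cong (0≲x⇒x≈x⊔0 h) (0≲x⇒x≈x⊔0 k))))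
  where
  nonNeg : ∀ {p q} → 0ℚ ℚ.≤ p → 0ℚ ℚ.≤ q → 0ℚ ℚ.≤ p ℚ.* q
  nonNeg {p} {q} 0≤p 0≤q = subst (ℚ._≤ p ℚ.* q) (ℚ.*-zeroʳ p)
    (ℚ.*-monoˡ-≤-nonNeg p {{ℚ.nonNegative 0≤p}} 0≤q)

0≲∣x∣ : ∀ x → 0ℝ ≲ ∣ x ∣
0≲∣x∣ x = pointwise-≲ λ n → let p = seq x n in
  ℚ.≤-trans (ℚ.0≤∣p∣ p) (∣p∣≤ (ℚ.p≤p⊔q p (ℚ.- p)) (ℚ.p≤q⊔p p (ℚ.- p)))

-- Parity of `g` as a sign.

-- The properties of ±1 that let one argument serve even and odd `g`. A rational `σ` is a constant
-- sequence, hence a single variable for the solver.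
record Sign (σ : ℚ) : Set where
  field
    involutive : σ ℚ.* σ ≡ 1ℚ
    0≲∣x∣+σx   : ∀ x → 0ℝ ≲ ∣ x ∣ + fromℚ σ * x

1-sign : Sign 1ℚ
1-sign = record
  { involutive = refl
  ; 0≲∣x∣+σx   = λ x → pointwise-≲ λ n → let p = seq x n in
      subst (ℚ._≤ (p ℚ.⊔ ℚ.- p) ℚ.+ 1ℚ ℚ.* p)
        (solve 1 (λ p → :- p :+ con 1ℚ :* p := con 0ℚ) refl p)
        (ℚ.+-monoˡ-≤ (1ℚ ℚ.* p) (ℚ.p≤q⊔p p (ℚ.- p)))
  }

-1-sign : Sign (ℚ.- 1ℚ)
-1-sign = record
  { involutive = refl
  ; 0≲∣x∣+σx   = λ x → pointwise-≲ λ n → let p = seq x n in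
      subst (ℚ._≤ (p ℚ.⊔ ℚ.- p) ℚ.+ (ℚ.- 1ℚ) ℚ.* p)
        (solve 1 (λ p → p :+ con (ℚ.- 1ℚ) :* p := con 0ℚ) refl p)
        (ℚ.+-monoˡ-≤ ((ℚ.- 1ℚ) ℚ.* p) (ℚ.p≤p⊔q p (ℚ.- p)))
  }

-- Parity speaks of `g` at a negated argument; `g` respects equality of reals, so `y - x` may be put
-- in that form.
swap-difference : ∀ (g : ℝ⟶ℝ) x y → g ⟨$⟩ (y - x) ≈ g ⟨$⟩ (- (x - y))
swap-difference g x y = wrap (Func.cong g {y - x} { - (x - y)} (_≈_.unwrap y-x≈-[x-y]))
  where
  y-x≈-[x-y] : y - x ≈ - (x - y)
  y-x≈-[x-y] = pointwise-≈ λ n →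
    solve 2 (λ p q → q :- p := :- (p :- q)) refl (seq x n) (seq y n)

parity-sign : ∀ g → 𝒢 g →
  ∃ λ σ → Sign σ × (∀ x y → g ⟨$⟩ (y - x) ≈ fromℚ σ * (g ⟨$⟩ (x - y)))
parity-sign g g∈𝒢 with 𝒢.parity g∈𝒢
... | inj₁ even = 1ℚ , 1-sign , λ x y →
  ≈-trans (swap-difference g x y) (≈-trans {y = g ⟨$⟩ (x - y)} (wrap (even (x - y)))
    (pointwise-≈ λ n → sym (ℚ.*-identityˡ (seq (g ⟨$⟩ (x - y)) n))))
... | inj₂ odd = ℚ.- 1ℚ , -1-sign , λ x y →
  ≈-trans (swap-difference g x y) (≈-trans {y = - (g ⟨$⟩ (x - y))} (wrap (odd (x - y)))
    (pointwise-≈ λ n → solve 1 (λ p → :- p := con (ℚ.- 1ℚ) :* p) refl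
      (seq (g ⟨$⟩ (x - y)) n)))

module Nondecreasing (g : ℝ⟶ℝ) (g∈𝒢 : 𝒢 g) where

  mono : 0ℝ ≲ x → x ≲ y → g ⟨$⟩ x ≲ g ⟨$⟩ y
  mono {x} {y} (wrap h) (wrap k) = wrap (𝒢.nondecreasing g∈𝒢 x y h k)

  nonNegative : 0ℝ ≲ x → 0ℝ ≲ g ⟨$⟩ x
  nonNegative h = ≲-trans (wrap (𝒢.nonNegative-at-0 g∈𝒢)) (mono ≲-refl h)

-- Polynomial inequalities behind the sum.

-- `b₂` and `b₄` absorb the sign. As `R - T` may be negative, a common weight `c` is split off from
-- `a₁` and `a₃` to pair it with `P - Q`.
weighted-sum-nonNegative : ∀ a₁ b₂ a₃ b₄ c P Q R T →
  0ℝ ≲ a₁ + b₂ → c ≲ a₁ → c ≲ a₃ → 0ℝ ≲ c → 0ℝ ≲ c + b₄ →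
  0ℝ ≲ Q → 0ℝ ≲ R → 0ℝ ≲ T → 0ℝ ≲ P - Q → 0ℝ ≲ (P - Q) + (R - T) →
  0ℝ ≲ a₁ * P + (b₂ * Q + (a₃ * R + b₄ * T))
weighted-sum-nonNegative a₁ b₂ a₃ b₄ c P Q R T
  0≲a₁+b₂ c≲a₁ c≲a₃ 0≲c 0≲c+b₄ 0≲Q 0≲R 0≲T 0≲P-Q 0≲P-Q+R-T =
  ≲-trans
    (0≲+ (0≲* 0≲a₁+b₂ 0≲Q)
    (0≲+ (0≲* (x≲y⇒0≲y-x c≲a₁) 0≲P-Q)
    (0≲+ (0≲* (x≲y⇒0≲y-x c≲a₃) 0≲R)
    (0≲+ (0≲* 0≲c+b₄ 0≲T)
         (0≲* 0≲c 0≲P-Q+R-T)))))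
    (≈⇒≲ (pointwise-≈ λ n →
      solve 9 (λ a₁ b₂ a₃ b₄ c P Q R T →
          (a₁ :+ b₂) :* Q :+ ((a₁ :- c) :* (P :- Q) :+ ((a₃ :- c) :* R
            :+ ((c :+ b₄) :* T :+ c :* ((P :- Q) :+ (R :- T)))))
        := a₁ :* P :+ (b₂ :* Q :+ (a₃ :* R :+ b₄ :* T)))
        refl (seq a₁ n) (seq b₂ n) (seq a₃ n) (seq b₄ n) (seq c n)
             (seq P n) (seq Q n) (seq R n) (seq T n)))

module Products (A B C D E F : ℝ)
  (0≲B : 0ℝ ≲ B) (0≲C : 0ℝ ≲ C)
  (C≲A : C ≲ A) (E≲D : E ≲ D) (C≲E : C ≲ E) (D≲F : D ≲ F) (B≲F : B ≲ F) where

  -- The factors follow the order of `product`: row i lists the values for j ≠ i increasing, with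
  -- signs removed.
  P Q R T : ℝ
  P = A * (D * F)
  Q = A * (B * E)
  R = D * (B * C)
  T = F * (E * C)

  private
    0≲A : 0ℝ ≲ A
    0≲A = ≲-trans 0≲C C≲A
    0≲E : 0ℝ ≲ E
    0≲E = ≲-trans 0≲C C≲E
    0≲D : 0ℝ ≲ D
    0≲D = ≲-trans 0≲E E≲D
    0≲F : 0ℝ ≲ F
    0≲F = ≲-trans 0≲D D≲F
    0≲A-C : 0ℝ ≲ A - C
    0≲A-C = x≲y⇒0≲y-x C≲A
    0≲D-E : 0ℝ ≲ D - E
    0≲D-E = x≲y⇒0≲y-x E≲D
    0≲F-B : 0ℝ ≲ F - B
    0≲F-B = x≲y⇒0≲y-x B≲F

  0≲Q : 0ℝ ≲ Q
  0≲Q = 0≲* 0≲A (0≲* 0≲B 0≲E)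

  0≲R : 0ℝ ≲ R
  0≲R = 0≲* 0≲D (0≲* 0≲B 0≲C)

  0≲T : 0ℝ ≲ T
  0≲T = 0≲* 0≲F (0≲* 0≲E 0≲C)

  -- With `A` factored out, pass from DF through EF to EB, changing one factor at a time; neither
  -- change increases the product.
  0≲P-Q : 0ℝ ≲ P - Q
  0≲P-Q = ≲-trans (0≲* 0≲A (0≲+ (0≲* 0≲F 0≲D-E) (0≲* 0≲E 0≲F-B)))
    (≈⇒≲ (pointwise-≈ λ n →
      solve 5 (λ A B D E F →
          A :* (F :* (D :- E) :+ E :* (F :- B))
        := A :* (D :* F) :- A :* (B :* E))
        refl (seq A n) (seq B n) (seq D n) (seq E n) (seq F n)))

  -- The expression is F(AD - EC) + B(DC - AE). Writing F = (F - B) + B leaves (F - B)(AD - EC) and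
  -- B(A + C)(D - E).
  0≲P-Q+R-T : 0ℝ ≲ (P - Q) + (R - T)
  0≲P-Q+R-T = ≲-trans
    (0≲+ (0≲* 0≲F-B (0≲+ (0≲* 0≲A 0≲D-E) (0≲* 0≲A-C 0≲E)))
         (0≲* 0≲B (0≲* (0≲+ 0≲A 0≲C) 0≲D-E)))
    (≈⇒≲ (pointwise-≈ λ n →
      solve 6 (λ A B C D E F →
          (F :- B) :* (A :* (D :- E) :+ (A :- C) :* E) :+ B :* ((A :+ C) :* (D :- E))
        := (A :* (D :* F) :- A :* (B :* E)) :+ (D :* (B :* C) :- F :* (E :* C)))
        refl (seq A n) (seq B n) (seq C n) (seq D n) (seq E n) (seq F n)))

theorem3 :
    (x₁ x₂ x₃ x₄ : ℝ) → x₁ ≥ x₂ → x₂ ≥ x₃ → x₃ ≥ x₄ → x₁ + x₄ ≥ x₂ + x₃ →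
    (a₁ a₂ a₃ a₄ : ℝ) → a₁ ≥ ∣ a₂ ∣ ⊔ ∣ a₄ ∣ → a₃ ≥ ∣ a₄ ∣ →
    (g : ℝ⟶ℝ) → 𝒢 g →
    let x : Vector ℝ 4
        x = x₁ ∷ x₂ ∷ x₃ ∷ x₄ ∷ []
        a : Vector ℝ 4
        a = a₁ ∷ a₂ ∷ a₃ ∷ a₄ ∷ []
    in sum (λ i → a i * product (removeAt (λ j → g ⟨$⟩ (x i - x j)) i)) ≥ 0ℝ
theorem3 x₁ x₂ x₃ x₄ x₁≥x₂ x₂≥x₃ x₃≥x₄ x₁+x₄≥x₂+x₃ a₁ a₂ a₃ a₄ a₁≥ a₃≥ g g∈𝒢
  with σ , σ-sign , flip ← parity-sign g g∈𝒢 =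
  _≲_.unwrap (≲-trans
    (weighted-sum-nonNegative a₁ (s * a₂) a₃ (s * a₄) ∣ a₄ ∣ P Q R T
      (≲-trans (0≲∣x∣+σx a₂) (+-mono-≲ ∣a₂∣≲a₁ ≲-refl))
      ∣a₄∣≲a₁ (wrap a₃≥) (0≲∣x∣ a₄) (0≲∣x∣+σx a₄)
      0≲Q 0≲R 0≲T 0≲P-Q 0≲P-Q+R-T)
    (≈⇒≲ (≈-sym
      -- `sum` unfolds to a right-nested sum ending in `0ℝ`, which is absorbed with the fourth term;
      -- each `product` ends in `1ℝ`.
      (+-cong term₁ (+-cong term₂ (+-cong term₃ term₄+0))))))
  where
  open Sign σ-sign
  open Nondecreasing g g∈𝒢

  s A B C D E F : ℝ
  s = fromℚ σ
  A = g ⟨$⟩ (x₁ - x₂)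
  B = g ⟨$⟩ (x₂ - x₃)
  C = g ⟨$⟩ (x₃ - x₄)
  D = g ⟨$⟩ (x₁ - x₃)
  E = g ⟨$⟩ (x₂ - x₄)
  F = g ⟨$⟩ (x₁ - x₄)

  x₂+x₃≲x₁+x₄ : x₂ + x₃ ≲ x₁ + x₄
  x₂+x₃≲x₁+x₄ = wrap x₁+x₄≥x₂+x₃
  x₂≲x₁ : x₂ ≲ x₁
  x₂≲x₁ = wrap x₁≥x₂
  x₃≲x₂ : x₃ ≲ x₂
  x₃≲x₂ = wrap x₂≥x₃
  x₄≲x₃ : x₄ ≲ x₃
  x₄≲x₃ = wrap x₃≥x₄
  0≲x₂-x₃ : 0ℝ ≲ x₂ - x₃
  0≲x₂-x₃ = x≲y⇒0≲y-x x₃≲x₂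
  0≲x₃-x₄ : 0ℝ ≲ x₃ - x₄
  0≲x₃-x₄ = x≲y⇒0≲y-x x₄≲x₃

  -- (x₁ - x₂) - (x₃ - x₄) is exactly the gap in `x₂+x₃≲x₁+x₄`; for `E≲D` the same gap is (x₁ - x₃)
  -- - (x₂ - x₄).
  C≲A : C ≲ A
  C≲A = mono 0≲x₃-x₄ (≲-by-difference (pointwise-≈ λ n →
    solve 4 (λ p q r t → (p :+ t) :- (q :+ r) := (p :- q) :- (r :- t))
      refl (seq x₁ n) (seq x₂ n) (seq x₃ n) (seq x₄ n)) x₂+x₃≲x₁+x₄)
  E≲D : E ≲ D
  E≲D = mono (x≲y⇒0≲y-x (≲-trans x₄≲x₃ x₃≲x₂)) (≲-by-difference (pointwise-≈ λ n →
    solve 4 (λ p q r t → (p :+ t) :- (q :+ r) := (p :- r) :- (q :- t))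
      refl (seq x₁ n) (seq x₂ n) (seq x₃ n) (seq x₄ n)) x₂+x₃≲x₁+x₄)
  C≲E : C ≲ E
  C≲E = mono 0≲x₃-x₄ (+-mono-≲ x₃≲x₂ ≲-refl)
  D≲F : D ≲ F
  D≲F = mono (x≲y⇒0≲y-x (≲-trans x₃≲x₂ x₂≲x₁)) (+-mono-≲ ≲-refl (neg-mono-≲ x₄≲x₃))
  B≲F : B ≲ F
  B≲F = mono 0≲x₂-x₃ (+-mono-≲ x₂≲x₁ (neg-mono-≲ x₄≲x₃))

  open Products A B C D E F
    (nonNegative 0≲x₂-x₃) (nonNegative 0≲x₃-x₄) C≲A E≲D C≲E D≲F B≲F

  ∣a₂∣≲a₁ : ∣ a₂ ∣ ≲ a₁
  ∣a₂∣≲a₁ = ≲-trans {y = ∣ a₂ ∣ ⊔ ∣ a₄ ∣}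
    (pointwise-≲ λ n → ℚ.p≤p⊔q (seq ∣ a₂ ∣ n) (seq ∣ a₄ ∣ n)) (wrap a₁≥)
  ∣a₄∣≲a₁ : ∣ a₄ ∣ ≲ a₁
  ∣a₄∣≲a₁ = ≲-trans {y = ∣ a₂ ∣ ⊔ ∣ a₄ ∣}
    (pointwise-≲ λ n → ℚ.p≤q⊔p (seq ∣ a₂ ∣ n) (seq ∣ a₄ ∣ n)) (wrap a₁≥)

  cancel-σσ : ∀ p → (σ ℚ.* σ) ℚ.* p ≡ p
  cancel-σσ p = trans (cong (ℚ._* p) involutive) (ℚ.*-identityˡ p)

  term₁ : a₁ * (A * (D * (F * 1ℝ))) ≈ a₁ * P
  term₁ = pointwise-≈ λ n →
    solve 4 (λ a p q r → a :* (p :* (q :* (r :* con 1ℚ))) := a :* (p :* (q :* r)))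
      refl (seq a₁ n) (seq A n) (seq D n) (seq F n)

  term₂ : a₂ * ((g ⟨$⟩ (x₂ - x₁)) * (B * (E * 1ℝ))) ≈ (s * a₂) * Q
  term₂ = ≈-trans (*-cong ≈-refl (*-cong (flip x₁ x₂) ≈-refl)) (pointwise-≈ λ n →
    solve 5 (λ s a p q r →
      a :* ((s :* p) :* (q :* (r :* con 1ℚ))) := (s :* a) :* (p :* (q :* r)))
      refl σ (seq a₂ n) (seq A n) (seq B n) (seq E n))

  term₃ : a₃ * ((g ⟨$⟩ (x₃ - x₁)) * ((g ⟨$⟩ (x₃ - x₂)) * (C * 1ℝ))) ≈ a₃ * R
  term₃ = ≈-trans
    (*-cong ≈-refl (*-cong (flip x₁ x₃) (*-cong (flip x₂ x₃) ≈-refl)))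
    (pointwise-≈ λ n → trans
      -- Two reversed differences give two signs. To the solver `σ` is a free variable, so they are
      -- collected in front for `cancel-σσ`.
      (solve 5 (λ s a p q r →
        a :* ((s :* p) :* ((s :* q) :* (r :* con 1ℚ)))
          := (s :* s) :* (a :* (p :* (q :* r))))
        refl σ (seq a₃ n) (seq D n) (seq B n) (seq C n))
      (cancel-σσ (seq (a₃ * R) n)))

  term₄+0 :
    a₄ * ((g ⟨$⟩ (x₄ - x₁)) * ((g ⟨$⟩ (x₄ - x₂)) * ((g ⟨$⟩ (x₄ - x₃)) * 1ℝ))) + 0ℝ
      ≈ (s * a₄) * T
  term₄+0 = ≈-trans
    (+-cong (*-cong ≈-refl (*-cong (flip x₁ x₄) (*-cong (flip x₂ x₄)
      (*-cong (flip x₃ x₄) ≈-refl)))) ≈-refl)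
    (pointwise-≈ λ n → trans
      -- Of three signs, two cancel and the third stays with `a₄`.
      (solve 5 (λ s a p q r →
        a :* ((s :* p) :* ((s :* q) :* ((s :* r) :* con 1ℚ))) :+ con 0ℚ
          := (s :* s) :* ((s :* a) :* (p :* (q :* r))))
        refl σ (seq a₄ n) (seq F n) (seq E n) (seq C n))
      (cancel-σσ (seq ((s * a₄) * T) n)))
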